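{- For a triangle-free graph $G$ without isolated vertices, the following are equivalent: (1) $G$ is localizable; (2) $G$ is very well-covered; (3) $G$ has a perfect matching every edge of which is a strong clique; (4) $G$ has a perfect matching, and every edge of every perfect matching of $G$ is a strong clique.
   Context: A clique is strong if it intersects every maximal independent set. A graph is localizable if its vertex set admits a partition into strong cliques. A graph is well-covered if all its maximal independent sets have the same size, and very well-covered if it is well-covered, has no isolated vertices, and its independence number equals $|V(G)|/2$. -}

module Defs where

open import Data.Fin.Base using (Fin)
open import Data.Fin.Subset
  using (Subset; _∈_; _⊆_; _∩_; _∪_; ⁅_⁆; ∣_∣; Nonempty; Empty)
open import Data.List.Base using (List)
open import Data.List.Relation.Unary.All using (All)
open import Data.List.Relation.Unary.AllPairs using (AllPairs)
open import Data.List.Relation.Unary.Any using (Any)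
open import Data.Nat.Base using (ℕ; _*_; _≤_)
open import Data.Product.Base using (∃-syntax; _×_)
open import Level using (0ℓ)
open import Relation.Binary.Core using (Rel)
open import Relation.Binary.Definitions using (Decidable; Irreflexive; Symmetric)
open import Relation.Binary.PropositionalEquality.Core using (_≡_; _≢_)
open import Relation.Nullary.Negation.Core using (¬_)

-- Finite simple graphs with vertex set Fin n.  Adjacency is decidable, so
-- that the constructive reading of the notions below is the classical one.

record Graph (n : ℕ) : Set₁ where
  infix 4 _~_ _~?_
  field
    _~_    : Rel (Fin n) 0ℓ
    sym    : Symmetric _~_
    irrefl : Irreflexive _≡_ _~_
    _~?_   : Decidable _~_

Disjoint : ∀ {n} → Subset n → Subset n → Set
Disjoint p q = Empty (p ∩ q)

Covers : ∀ {n} → List (Subset n) → Set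
Covers {n} ps = (v : Fin n) → Any (v ∈_) ps

-- A finite family of sets is listed in an arbitrary order; pairwise
-- disjointness of nonempty blocks rules out repetitions.

record IsPartition {n : ℕ} (ps : List (Subset n)) : Set where
  field
    nonempty : All Nonempty ps
    disjoint : AllPairs Disjoint ps
    covers   : Covers ps

module _ {n : ℕ} (G : Graph n) where
  open Graph G

  -- The three vertices are automatically distinct, as _~_ is irreflexive.
  TriangleFree : Set
  TriangleFree = ∀ {x y z} → x ~ y → y ~ z → ¬ (x ~ z)

  NoIsolatedVertices : Set
  NoIsolatedVertices = (v : Fin n) → ∃[ u ] v ~ u

  IsClique : Subset n → Set
  IsClique C = ∀ {x y} → x ∈ C → y ∈ C → x ≢ y → x ~ y

  IsIndependent : Subset n → Set
  IsIndependent I = ∀ {x y} → x ∈ I → y ∈ I → ¬ (x ~ y)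

  -- Maximal with respect to inclusion.
  record IsMaximalIndependent (I : Subset n) : Set where
    field
      independent : IsIndependent I
      maximal     : ∀ {J} → IsIndependent J → I ⊆ J → J ⊆ I

  record IsStrongClique (C : Subset n) : Set where
    field
      clique : IsClique C
      strong : ∀ {I} → IsMaximalIndependent I → Nonempty (C ∩ I)

  Localizable : Set
  Localizable = ∃[ ps ] IsPartition ps × All IsStrongClique ps

  WellCovered : Set
  WellCovered =
    ∀ {I J} → IsMaximalIndependent I → IsMaximalIndependent J → ∣ I ∣ ≡ ∣ J ∣

  record IsIndependenceNumber (α : ℕ) : Set where
    field
      attained : ∃[ I ] IsIndependent I × ∣ I ∣ ≡ α
      bound    : ∀ {I} → IsIndependent I → ∣ I ∣ ≤ α

  -- α = |V(G)|/2 is exact halving, so it is stated as 2α = |V(G)|.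
  record VeryWellCovered : Set where
    field
      wellCovered : WellCovered
      noIsolated  : NoIsolatedVertices
      halfOrder   : ∃[ α ] IsIndependenceNumber α × 2 * α ≡ n

  -- An edge is the two-element set of its endpoints.
  IsEdge : Subset n → Set
  IsEdge e = ∃[ u ] ∃[ v ] u ~ v × e ≡ ⁅ u ⁆ ∪ ⁅ v ⁆

  record IsPerfectMatching (M : List (Subset n)) : Set where
    field
      edges    : All IsEdge M
      disjoint : AllPairs Disjoint M
      covers   : Covers M

{-# OPTIONS --safe #-}

-- In a triangle-free graph without isolated vertices the strong cliques are
-- edges, so (1) and (3) agree.  Counting independent sets along the edges of
-- a perfect matching gives the other implications, except the existence of a
-- perfect matching in a very well-covered graph.  For the latter, an independent set S is matched
-- into its neighbourhood by recursion: choose y with A = N(y) ∩ S minimal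
-- among the nonempty sets of this form, let L be a maximal independent set
-- containing y and S ∖ A, and let B be the set of vertices of L with a
-- neighbour in S.  Such a neighbour lies in A because L is independent, so by
-- minimality A is completely joined to B.  As (L ∖ B) ∪ A is independent,
-- ∣A∣ ≤ ∣B∣, and A can be matched into B.  Nothing in B is adjacent to
-- S ∖ A, so the recursion continues with S ∖ A.

module Submission where

open import Defs
open import Data.Fin.Base using (Fin)
open import Data.Fin.Properties using (_≟_; any?)
open import Data.Fin.Subset
  using (Subset; inside; outside; _∈_; _∉_; _⊆_; _⊂_; _∩_; _∪_; ∁; ⋃; ⊤; ⊥; ⁅_⁆;
         ∣_∣; Nonempty; Empty)
open import Data.Fin.Subset.Induction using (⊂-wellFounded; ⊃-wellFounded; Acc; acc)
open import Data.Fin.Subset.Properties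
open import Data.List.Base using (List; []; _∷_; _++_; length; map)
open import Data.List.Relation.Unary.All as All using (All; []; _∷_)
import Data.List.Relation.Unary.All.Properties as All
open import Data.List.Relation.Unary.AllPairs using (AllPairs; []; _∷_)
import Data.List.Relation.Unary.AllPairs.Properties as AllPairs
open import Data.List.Relation.Unary.Any as Any using (Any; here; there)
import Data.List.Relation.Unary.Any.Properties as Any
open import Data.Nat.Base using (ℕ; suc; _+_; _*_; _≤_; z≤n; s≤s⁻¹)
open import Data.Nat.ListAction using (sum)
open import Data.Nat.Properties
  using (≤-refl; ≤-reflexive; ≤-trans; ≤-antisym; +-suc; +-comm; *-comm; *-identityʳ; +-mono-≤;
         +-monoˡ-≤; +-cancelˡ-≤; +-cancelʳ-≤; *-monoʳ-≤; *-cancelˡ-≡;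
         module ≤-Reasoning)
open import Data.Product.Base using (∃-syntax; _×_; _,_; proj₁; proj₂)
open import Data.Sum.Base using (inj₁; inj₂; [_,_]′)
open import Data.Vec.Base using ([]; _∷_; here; tabulate)
open import Data.Vec.Properties using (lookup∘tabulate; lookup⇒[]=; []=⇒lookup)
open import Function.Base using (_∘_)
open import Function.Bundles using (_⇔_; mk⇔)
open import Relation.Binary.PropositionalEquality
  using (_≡_; refl; sym; trans; cong; cong₂; subst; module ≡-Reasoning)
open import Relation.Nullary using (¬_; yes; no; does; contradiction; ¬?; _×-dec_)
open import Relation.Nullary.Decidable using (dec-true; decidable-stable)
open import Relation.Unary using (Pred; Decidable)
open import Level using (0ℓ)

-- Finite sets

x∈p∩∁q⁺ : ∀ {n x} {p q : Subset n} → x ∈ p → x ∉ q → x ∈ p ∩ ∁ q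
x∈p∩∁q⁺ x∈p x∉q = x∈p∩q⁺ (x∈p , x∉p⇒x∈∁p x∉q)

x∈p∩∁q⁻ : ∀ {n x} (p q : Subset n) → x ∈ p ∩ ∁ q → x ∈ p × x ∉ q
x∈p∩∁q⁻ p q x∈ with x∈p , x∈∁q ← x∈p∩q⁻ p (∁ q) x∈ = x∈p , x∈∁p⇒x∉p x∈∁q

p⊆q∪p∩∁q : ∀ {n} (p q : Subset n) → p ⊆ q ∪ (p ∩ ∁ q)
p⊆q∪p∩∁q p q {x} x∈p with x ∈? q
... | yes x∈q = x∈p∪q⁺ (inj₁ x∈q)
... | no  x∉q = x∈p∪q⁺ (inj₂ (x∈p∩∁q⁺ x∈p x∉q))

∣p∣≡∣p∩q∣+∣p∩∁q∣ : ∀ {n} (p q : Subset n) → ∣ p ∣ ≡ ∣ p ∩ q ∣ + ∣ p ∩ ∁ q ∣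
∣p∣≡∣p∩q∣+∣p∩∁q∣ []            []            = refl
∣p∣≡∣p∩q∣+∣p∩∁q∣ (outside ∷ p) (_ ∷ q)       = ∣p∣≡∣p∩q∣+∣p∩∁q∣ p q
∣p∣≡∣p∩q∣+∣p∩∁q∣ (inside ∷ p)  (inside ∷ q)  = cong suc (∣p∣≡∣p∩q∣+∣p∩∁q∣ p q)
∣p∣≡∣p∩q∣+∣p∩∁q∣ (inside ∷ p)  (outside ∷ q) =
  trans (cong suc (∣p∣≡∣p∩q∣+∣p∩∁q∣ p q)) (sym (+-suc _ _))

∣p∪q∣≡∣p∣+∣q∣ : ∀ {n} (p q : Subset n) → Disjoint p q → ∣ p ∪ q ∣ ≡ ∣ p ∣ + ∣ q ∣
∣p∪q∣≡∣p∣+∣q∣ []            []            d = refl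
∣p∪q∣≡∣p∣+∣q∣ (outside ∷ p) (outside ∷ q) d = ∣p∪q∣≡∣p∣+∣q∣ p q (drop-∷-Empty d)
∣p∪q∣≡∣p∣+∣q∣ (outside ∷ p) (inside ∷ q)  d =
  trans (cong suc (∣p∪q∣≡∣p∣+∣q∣ p q (drop-∷-Empty d))) (sym (+-suc _ _))
∣p∪q∣≡∣p∣+∣q∣ (inside ∷ p)  (outside ∷ q) d = cong suc (∣p∪q∣≡∣p∣+∣q∣ p q (drop-∷-Empty d))
∣p∪q∣≡∣p∣+∣q∣ (inside ∷ p)  (inside ∷ q)  d = contradiction (_ , here) d

q⊆p⇒p∩q≡q : ∀ {n} {p q : Subset n} → q ⊆ p → p ∩ q ≡ q
q⊆p⇒p∩q≡q {p = p} {q} q⊆p = ⊆-antisym (p∩q⊆q p q) (λ x∈q → x∈p∩q⁺ (q⊆p x∈q , x∈q))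

⁅x⁆⊆p : ∀ {n x} {p : Subset n} → x ∈ p → ⁅ x ⁆ ⊆ p
⁅x⁆⊆p {x = x} {p} x∈p y∈ = subst (_∈ p) (sym (x∈⁅y⁆⇒x≡y x y∈)) x∈p

x∈p⇒∣p∣≡1+∣p∩∁⁅x⁆∣ : ∀ {n x} {p : Subset n} → x ∈ p → ∣ p ∣ ≡ suc ∣ p ∩ ∁ ⁅ x ⁆ ∣
x∈p⇒∣p∣≡1+∣p∩∁⁅x⁆∣ {x = x} {p} x∈p = begin
  ∣ p ∣                             ≡⟨ ∣p∣≡∣p∩q∣+∣p∩∁q∣ p ⁅ x ⁆ ⟩
  ∣ p ∩ ⁅ x ⁆ ∣ + ∣ p ∩ ∁ ⁅ x ⁆ ∣   ≡⟨ cong (λ q → ∣ q ∣ + ∣ p ∩ ∁ ⁅ x ⁆ ∣) (q⊆p⇒p∩q≡q (⁅x⁆⊆p x∈p)) ⟩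
  ∣ ⁅ x ⁆ ∣ + ∣ p ∩ ∁ ⁅ x ⁆ ∣       ≡⟨ cong (_+ ∣ p ∩ ∁ ⁅ x ⁆ ∣) (∣⁅x⁆∣≡1 x) ⟩
  suc ∣ p ∩ ∁ ⁅ x ⁆ ∣               ∎
  where open ≡-Reasoning

Nonempty⇒1≤∣p∣ : ∀ {n} {p : Subset n} → Nonempty p → 1 ≤ ∣ p ∣
Nonempty⇒1≤∣p∣ (x , x∈p) = subst (_≤ _) (∣⁅x⁆∣≡1 x) (p⊆q⇒∣p∣≤∣q∣ (⁅x⁆⊆p x∈p))

1≤∣p∣⇒Nonempty : ∀ {n} {p : Subset n} → 1 ≤ ∣ p ∣ → Nonempty p
1≤∣p∣⇒Nonempty {n} {p} 1≤∣p∣ with nonempty? p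
... | yes ne = ne
... | no  e  with () ← subst (1 ≤_) (trans (cong ∣_∣ (Empty-unique e)) (∣⊥∣≡0 n)) 1≤∣p∣

subsingleton⇒∣p∣≤1 : ∀ {n} {p : Subset n} → (∀ {x y} → x ∈ p → y ∈ p → x ≡ y) → ∣ p ∣ ≤ 1
subsingleton⇒∣p∣≤1 {n} {p} unique with nonempty? p
... | no  e         = subst (_≤ 1) (sym (trans (cong ∣_∣ (Empty-unique e)) (∣⊥∣≡0 n))) z≤n
... | yes (x , x∈p) = subst (∣ p ∣ ≤_) (∣⁅x⁆∣≡1 x)
  (p⊆q⇒∣p∣≤∣q∣ (λ y∈p → subst (_∈ ⁅ x ⁆) (unique x∈p y∈p) (x∈⁅x⁆ x)))

x∈⁅u⁆∪⁅v⁆⁻ : ∀ {n} {x u v : Fin n} {P : Fin n → Set} → P u → P v → x ∈ ⁅ u ⁆ ∪ ⁅ v ⁆ → P x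
x∈⁅u⁆∪⁅v⁆⁻ {u = u} {v} {P} pu pv x∈ with x∈p∪q⁻ ⁅ u ⁆ ⁅ v ⁆ x∈
... | inj₁ x∈u = subst P (sym (x∈⁅y⁆⇒x≡y u x∈u)) pu
... | inj₂ x∈v = subst P (sym (x∈⁅y⁆⇒x≡y v x∈v)) pv

-- Subsets cut out by decidable predicates, and minimal choices

module _ {n} {P : Pred (Fin n) 0ℓ} (P? : Decidable P) where

  comprehension : Subset n
  comprehension = tabulate (does ∘ P?)

  ∈-comprehension⁺ : ∀ {x} → P x → x ∈ comprehension
  ∈-comprehension⁺ {x} px =
    lookup⇒[]= x _ (trans (lookup∘tabulate (does ∘ P?) x) (dec-true (P? x) px))

  ∈-comprehension⁻ : ∀ {x} → x ∈ comprehension → P x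
  ∈-comprehension⁻ {x} x∈ with P? x | trans (sym (lookup∘tabulate (does ∘ P?) x)) ([]=⇒lookup x∈)
  ... | yes px | _ = px

module _ {m n} {P : Pred (Fin m) 0ℓ} (P? : Decidable P) (f : Fin m → Subset n) where

  -- Descent along strict inclusion of the values of `f`; since `Fin m` is finite and `P` decidable,
  -- a failure to descend can be detected.
  ∃-⊆-minimal : ∀ x → P x → ∃[ y ] P y × (∀ {z} → P z → f z ⊆ f y → f y ⊆ f z)
  ∃-⊆-minimal x px = go x px (⊂-wellFounded (f x))
    where
    go : ∀ x → P x → Acc _⊂_ (f x) → ∃[ y ] P y × (∀ {z} → P z → f z ⊆ f y → f y ⊆ f z)
    go x px (acc rec) with any? (λ z → P? z ×-dec f z ⊂? f x)
    ... | yes (z , pz , z⊂x) = go z pz (rec z⊂x)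
    ... | no  none           = x , px , λ {z} pz fz⊆fx {v} v∈fx →
      decidable-stable (v ∈? f z) (λ v∉fz → none (z , pz , fz⊆fx , v , v∈fx , v∉fz))

-- Families of pairwise disjoint sets

∈⋃⁺ : ∀ {n v} {ps : List (Subset n)} → Any (v ∈_) ps → v ∈ ⋃ ps
∈⋃⁺ (here v∈p)  = x∈p∪q⁺ (inj₁ v∈p)
∈⋃⁺ (there v∈ps) = x∈p∪q⁺ (inj₂ (∈⋃⁺ v∈ps))

∈⋃⁻ : ∀ {n v} (ps : List (Subset n)) → v ∈ ⋃ ps → Any (v ∈_) ps
∈⋃⁻ []       v∈ = contradiction v∈ ∉⊥
∈⋃⁻ (p ∷ ps) v∈ = [ here , there ∘ ∈⋃⁻ ps ]′ (x∈p∪q⁻ p (⋃ ps) v∈)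

disjoint-⋃ : ∀ {n} {p : Subset n} {ps} → All (Disjoint p) ps → Disjoint p (⋃ ps)
disjoint-⋃ {p = p} {ps} ds (v , v∈) with v∈p , v∈⋃ ← x∈p∩q⁻ p (⋃ ps) v∈ =
  All.lookupWith (λ d v∈q → d (v , x∈p∩q⁺ (v∈p , v∈q))) ds (∈⋃⁻ ps v∈⋃)

∣⋃∣≡sum : ∀ {n} {ps : List (Subset n)} → AllPairs Disjoint ps → ∣ ⋃ ps ∣ ≡ sum (map ∣_∣ ps)
∣⋃∣≡sum {n} []                = ∣⊥∣≡0 n
∣⋃∣≡sum (_∷_ {p} {ps} d ds) =
  trans (∣p∪q∣≡∣p∣+∣q∣ p (⋃ ps) (disjoint-⋃ d)) (cong (∣ p ∣ +_) (∣⋃∣≡sum ds))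

∣⋃∩q∣≡sum : ∀ {n} {ps : List (Subset n)} (q : Subset n) → AllPairs Disjoint ps →
            ∣ ⋃ ps ∩ q ∣ ≡ sum (map (λ p → ∣ p ∩ q ∣) ps)
∣⋃∩q∣≡sum {n} q [] = trans (cong ∣_∣ (∩-zeroˡ q)) (∣⊥∣≡0 n)
∣⋃∩q∣≡sum q (_∷_ {p} {ps} d ds) = begin
  ∣ (p ∪ ⋃ ps) ∩ q ∣                                ≡⟨ cong ∣_∣ (∩-distribʳ-∪ q p (⋃ ps)) ⟩
  ∣ (p ∩ q) ∪ (⋃ ps ∩ q) ∣                          ≡⟨ ∣p∪q∣≡∣p∣+∣q∣ (p ∩ q) (⋃ ps ∩ q) d′ ⟩
  ∣ p ∩ q ∣ + ∣ ⋃ ps ∩ q ∣                          ≡⟨ cong (∣ p ∩ q ∣ +_) (∣⋃∩q∣≡sum q ds) ⟩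
  ∣ p ∩ q ∣ + sum (map (λ p → ∣ p ∩ q ∣) ps)        ∎
  where
  open ≡-Reasoning
  d′ : Disjoint (p ∩ q) (⋃ ps ∩ q)
  d′ (v , v∈) with l , r ← x∈p∩q⁻ (p ∩ q) (⋃ ps ∩ q) v∈ =
    disjoint-⋃ d (v , x∈p∩q⁺ (p∩q⊆p p q l , p∩q⊆p (⋃ ps) q r))

-- Every later count goes block by block through this identity. Only the points of `q` have to be
-- covered, so it applies also to matchings that are not perfect.
∣q∣≡sum : ∀ {n} {ps : List (Subset n)} {q} → AllPairs Disjoint ps →
          (∀ {v} → v ∈ q → Any (v ∈_) ps) → ∣ q ∣ ≡ sum (map (λ p → ∣ p ∩ q ∣) ps)
∣q∣≡sum {q = q} disj cov =
  trans (cong ∣_∣ (sym (q⊆p⇒p∩q≡q (∈⋃⁺ ∘ cov)))) (∣⋃∩q∣≡sum q disj)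

-- Sums with constant or bounded terms

module _ {A : Set} (f : A → ℕ) where

  sum-const : ∀ {c xs} → All (λ x → f x ≡ c) xs → sum (map f xs) ≡ length xs * c
  sum-const []       = refl
  sum-const (e ∷ es) = cong₂ _+_ e (sum-const es)

  sum≤length : ∀ {xs} → All (λ x → f x ≤ 1) xs → sum (map f xs) ≤ length xs
  sum≤length []       = z≤n
  sum≤length (b ∷ bs) = +-mono-≤ b (sum≤length bs)

  -- Equality case of `sum≤length`: the other terms supply at most one each, so none can make up for
  -- a term equal to zero.
  length≤sum⇒1≤ : ∀ {xs} → All (λ x → f x ≤ 1) xs → length xs ≤ sum (map f xs) →
                  All (λ x → 1 ≤ f x) xs
  length≤sum⇒1≤ []                   _ = []
  length≤sum⇒1≤ (_∷_ {x} {xs} b bs) l =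
    +-cancelʳ-≤ (length xs) 1 (f x) (≤-trans l (+-mono-≤ ≤-refl (sum≤length bs))) ∷
    length≤sum⇒1≤ bs (s≤s⁻¹ (≤-trans l (+-monoˡ-≤ _ b)))

module _ {n : ℕ} (G : Graph n) where
  open Graph G renaming (sym to ~-sym)

  -- Neighbourhoods

  neighbours : Fin n → Subset n
  neighbours v = comprehension (v ~?_)

  hasNeighbourIn? : (S : Subset n) → Decidable (λ v → ∃[ u ] u ∈ S × v ~ u)
  hasNeighbourIn? S v = any? (λ u → u ∈? S ×-dec v ~? u)

  neighbourhood : Subset n → Subset n
  neighbourhood S = comprehension (hasNeighbourIn? S)

  -- Independent sets

  independent-⊆ : ∀ {S T} → S ⊆ T → IsIndependent G T → IsIndependent G S
  independent-⊆ S⊆T indT x∈S y∈S = indT (S⊆T x∈S) (S⊆T y∈S)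

  independent-⁅⁆ : ∀ v → IsIndependent G ⁅ v ⁆
  independent-⁅⁆ v x∈ y∈ = irrefl (trans (x∈⁅y⁆⇒x≡y v x∈) (sym (x∈⁅y⁆⇒x≡y v y∈)))

  independent-∪ : ∀ {S T} → IsIndependent G S → IsIndependent G T →
                  (∀ {x y} → x ∈ S → y ∈ T → ¬ x ~ y) → IsIndependent G (S ∪ T)
  independent-∪ {S} {T} indS indT none x∈ y∈ x~y with x∈p∪q⁻ S T x∈ | x∈p∪q⁻ S T y∈
  ... | inj₁ x∈S | inj₁ y∈S = indS x∈S y∈S x~y
  ... | inj₁ x∈S | inj₂ y∈T = none x∈S y∈T x~y
  ... | inj₂ x∈T | inj₁ y∈S = none y∈S x∈T (~-sym x~y)
  ... | inj₂ x∈T | inj₂ y∈T = indT x∈T y∈T x~y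

  -- Greedy extension: a vertex outside `S` without neighbours in `S` is added as long as there is
  -- one. When there is none, every vertex outside `S` is blocked by a neighbour in `S`, which is
  -- maximality.
  extend : ∀ {S} → IsIndependent G S → ∃[ I ] IsMaximalIndependent G I × S ⊆ I
  extend {S} = go S (⊃-wellFounded S)
    where
    go : ∀ S → Acc (λ p q → q ⊂ p) S → IsIndependent G S →
         ∃[ I ] IsMaximalIndependent G I × S ⊆ I
    go S (acc rec) indS with any? (λ v → ¬? (v ∈? S) ×-dec ¬? (hasNeighbourIn? S v))
    ... | yes (v , v∉S , free) =
      let I , maxI , S∪v⊆I = go (S ∪ ⁅ v ⁆) (rec (p⊆p∪q ⁅ v ⁆ , v , q⊆p∪q S ⁅ v ⁆ (x∈⁅x⁆ v) , v∉S))
            (independent-∪ indS (independent-⁅⁆ v) (λ {x} {y} x∈S y∈v x~y →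
              free (x , x∈S , subst (_~ x) (x∈⁅y⁆⇒x≡y v y∈v) (~-sym x~y))))
      in I , maxI , S∪v⊆I ∘ p⊆p∪q ⁅ v ⁆
    ... | no  none = S , record { independent = indS ; maximal = maximal } , ⊆-refl
      where
      maximal : ∀ {J} → IsIndependent G J → S ⊆ J → J ⊆ S
      maximal indJ S⊆J {v} v∈J = decidable-stable (v ∈? S) (λ v∉S →
        none (v , v∉S , λ (u , u∈S , v~u) → indJ v∈J (S⊆J u∈S) v~u))

  ∣independent∣≤∣maximal∣ : WellCovered G → ∀ {S I} → IsIndependent G S →
                            IsMaximalIndependent G I → ∣ S ∣ ≤ ∣ I ∣
  ∣independent∣≤∣maximal∣ wc indS maxI with _ , maxJ , S⊆J ← extend indS =
    ≤-trans (p⊆q⇒∣p∣≤∣q∣ S⊆J) (≤-reflexive (wc maxJ maxI))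

  -- An independent set attaining `α` extends to a maximal one, and well-coveredness transfers the
  -- lower bound `α` to `I`.
  2∣maximal∣≡n : VeryWellCovered G → ∀ {I} → IsMaximalIndependent G I → 2 * ∣ I ∣ ≡ n
  2∣maximal∣≡n vwc {I} maxI with α , isα , 2α≡n ← VeryWellCovered.halfOrder vwc =
    trans (cong (2 *_) (≤-antisym (bound (IsMaximalIndependent.independent maxI)) α≤∣I∣)) 2α≡n
    where
    open IsIndependenceNumber isα
    α≤∣I∣ : α ≤ ∣ I ∣
    α≤∣I∣ with _ , indJ , ∣J∣≡α ← attained =
      subst (_≤ _) ∣J∣≡α (∣independent∣≤∣maximal∣ (VeryWellCovered.wellCovered vwc) indJ maxI)

  -- Edges and matchings

  edge-clique : ∀ {e} → IsEdge G e → IsClique G e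
  edge-clique (u , v , u~v , refl) x∈ y∈ x≢y
    with x∈p∪q⁻ ⁅ u ⁆ ⁅ v ⁆ x∈ | x∈p∪q⁻ ⁅ u ⁆ ⁅ v ⁆ y∈
  ... | inj₁ x∈u | inj₁ y∈u = contradiction (trans (x∈⁅y⁆⇒x≡y u x∈u) (sym (x∈⁅y⁆⇒x≡y u y∈u))) x≢y
  ... | inj₂ x∈v | inj₂ y∈v = contradiction (trans (x∈⁅y⁆⇒x≡y v x∈v) (sym (x∈⁅y⁆⇒x≡y v y∈v))) x≢y
  ... | inj₁ x∈u | inj₂ y∈v
    rewrite x∈⁅y⁆⇒x≡y u x∈u | x∈⁅y⁆⇒x≡y v y∈v = u~v
  ... | inj₂ x∈v | inj₁ y∈u
    rewrite x∈⁅y⁆⇒x≡y v x∈v | x∈⁅y⁆⇒x≡y u y∈u = ~-sym u~v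

  edge-nonempty : ∀ {e} → IsEdge G e → Nonempty e
  edge-nonempty (u , v , _ , refl) = u , p⊆p∪q ⁅ v ⁆ (x∈⁅x⁆ u)

  ∣edge∣≡2 : ∀ {e} → IsEdge G e → ∣ e ∣ ≡ 2
  ∣edge∣≡2 (u , v , u~v , refl) =
    trans (∣p∪q∣≡∣p∣+∣q∣ ⁅ u ⁆ ⁅ v ⁆ d) (cong₂ _+_ (∣⁅x⁆∣≡1 u) (∣⁅x⁆∣≡1 v))
    where
    d : Disjoint ⁅ u ⁆ ⁅ v ⁆
    d (x , x∈) with x∈u , x∈v ← x∈p∩q⁻ ⁅ u ⁆ ⁅ v ⁆ x∈ =
      irrefl (trans (sym (x∈⁅y⁆⇒x≡y u x∈u)) (x∈⁅y⁆⇒x≡y v x∈v)) u~v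

  ∣clique∩independent∣≤1 : ∀ {C J} → IsClique G C → IsIndependent G J → ∣ C ∩ J ∣ ≤ 1
  ∣clique∩independent∣≤1 {C} {J} clq ind = subsingleton⇒∣p∣≤1 unique
    where
    unique : ∀ {x y} → x ∈ C ∩ J → y ∈ C ∩ J → x ≡ y
    unique {x} {y} x∈ y∈ with x∈C , x∈J ← x∈p∩q⁻ C J x∈ | y∈C , y∈J ← x∈p∩q⁻ C J y∈ =
      decidable-stable (x ≟ y) (ind x∈J y∈J ∘ clq x∈C y∈C)

  ∣⋃edges∣≡2∣M∣ : ∀ {M} → All (IsEdge G) M → AllPairs Disjoint M → ∣ ⋃ M ∣ ≡ length M * 2
  ∣⋃edges∣≡2∣M∣ edges disj = trans (∣⋃∣≡sum disj) (sum-const ∣_∣ (All.map ∣edge∣≡2 edges))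

  ∣e∩J∣≤1 : ∀ {M J} → All (IsEdge G) M → IsIndependent G J → All (λ e → ∣ e ∩ J ∣ ≤ 1) M
  ∣e∩J∣≤1 edges ind = All.map (λ e → ∣clique∩independent∣≤1 (edge-clique e) ind) edges

  -- Each vertex of `J` lies on an edge of `M`, and each edge contains at most one of them.
  ∣independent∣≤∣M∣ : ∀ {M J} → All (IsEdge G) M → AllPairs Disjoint M →
                      (∀ {v} → v ∈ J → Any (v ∈_) M) → IsIndependent G J → ∣ J ∣ ≤ length M
  ∣independent∣≤∣M∣ {J = J} edges disj cov ind =
    subst (_≤ _) (sym (∣q∣≡sum disj cov)) (sum≤length (λ e → ∣ e ∩ J ∣) (∣e∩J∣≤1 edges ind))

  ∣M∣*2≡n : ∀ {M} → IsPerfectMatching G M → length M * 2 ≡ n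
  ∣M∣*2≡n {M} pm = begin
    length M * 2   ≡⟨ ∣⋃edges∣≡2∣M∣ edges disjoint ⟨
    ∣ ⋃ M ∣        ≡⟨ cong ∣_∣ (⊆-antisym (⊆-max (⋃ M)) (λ {v} _ → ∈⋃⁺ (covers v))) ⟩
    ∣ ⊤ {n} ∣      ≡⟨ ∣⊤∣≡n n ⟩
    n              ∎
    where
    open IsPerfectMatching pm
    open ≡-Reasoning

  -- `T` bounds the vertices used by the matching, so that matchings inside disjoint sets can be
  -- joined.
  record MatchingWithin (S T : Subset n) : Set where
    field
      matching  : List (Subset n)
      edges     : All (IsEdge G) matching
      disjoint  : AllPairs Disjoint matching
      saturates : ∀ {v} → v ∈ S → Any (v ∈_) matching
      within    : ∀ {v} → Any (v ∈_) matching → v ∈ T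

  open MatchingWithin

  matching-∅ : ∀ {S T} → Empty S → MatchingWithin S T
  matching-∅ e = record
    { matching  = []
    ; edges     = []
    ; disjoint  = []
    ; saturates = λ v∈S → contradiction (_ , v∈S) e
    ; within    = λ ()
    }

  matching-edge : ∀ {u v} → u ~ v → MatchingWithin ⁅ u ⁆ (⁅ u ⁆ ∪ ⁅ v ⁆)
  matching-edge {u} {v} u~v = record
    { matching  = (⁅ u ⁆ ∪ ⁅ v ⁆) ∷ []
    ; edges     = (u , v , u~v , refl) ∷ []
    ; disjoint  = [] ∷ []
    ; saturates = λ w∈ → here (p⊆p∪q ⁅ v ⁆ w∈)
    ; within    = λ { (here w∈) → w∈ }
    }

  matching-∪ : ∀ {S T S′ T′} → MatchingWithin S T → MatchingWithin S′ T′ → Disjoint T T′ →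
               MatchingWithin (S ∪ S′) (T ∪ T′)
  matching-∪ {S} {T} {S′} {T′} m m′ d = record
    { matching  = matching m ++ matching m′
    ; edges     = All.++⁺ (edges m) (edges m′)
    ; disjoint  = AllPairs.++⁺ (disjoint m) (disjoint m′)
        (All.tabulate (λ e∈ → All.tabulate (λ e′∈ (v , v∈) →
          let v∈e , v∈e′ = x∈p∩q⁻ _ _ v∈
          in d (v , x∈p∩q⁺ (within m (Any.map (λ { refl → v∈e }) e∈)
                           , within m′ (Any.map (λ { refl → v∈e′ }) e′∈))))))
    ; saturates = λ v∈ → [ Any.++⁺ˡ ∘ saturates m
                         , Any.++⁺ʳ (matching m) ∘ saturates m′ ]′ (x∈p∪q⁻ S S′ v∈)
    ; within    = λ v∈ → x∈p∪q⁺ ([ inj₁ ∘ within m , inj₂ ∘ within m′ ]′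
                                   (Any.++⁻ (matching m) v∈))
    }

  matching-mono : ∀ {S T S′ T′} → S′ ⊆ S → T ⊆ T′ → MatchingWithin S T → MatchingWithin S′ T′
  matching-mono S′⊆S T⊆T′ m = record
    { matching  = matching m
    ; edges     = edges m
    ; disjoint  = disjoint m
    ; saturates = saturates m ∘ S′⊆S
    ; within    = T⊆T′ ∘ within m
    }

  -- Greedy matching: any `a` in `A` is paired with any `b` in `B`, and both are removed.
  -- Completeness and the inequality of sizes survive the removal.
  matching-complete : ∀ {A B} → (∀ {a b} → a ∈ A → b ∈ B → a ~ b) → ∣ A ∣ ≤ ∣ B ∣ →
                      MatchingWithin A (A ∪ B)
  matching-complete {A} = go A (⊂-wellFounded A)
    where
    go : ∀ A → Acc _⊂_ A → ∀ {B} → (∀ {a b} → a ∈ A → b ∈ B → a ~ b) → ∣ A ∣ ≤ ∣ B ∣ →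
         MatchingWithin A (A ∪ B)
    go A (acc rec) {B} complete ∣A∣≤∣B∣ with nonempty? A
    ... | no  e         = matching-∅ e
    ... | yes (a , a∈A) with 1≤∣p∣⇒Nonempty (≤-trans (Nonempty⇒1≤∣p∣ (a , a∈A)) ∣A∣≤∣B∣)
    ...   | b , b∈B =
      matching-mono (p⊆q∪p∩∁q A ⁅ a ⁆) ⊆A∪B
        (matching-∪ (matching-edge (complete a∈A b∈B))
          (go A′ (rec A′⊂A) (λ x∈ y∈ → complete (p∩q⊆p A _ x∈) (p∩q⊆p B _ y∈)) ∣A′∣≤∣B′∣)
          d)
      where
      A′ B′ : Subset n
      A′ = A ∩ ∁ ⁅ a ⁆
      B′ = B ∩ ∁ ⁅ b ⁆
      A′⊂A : A′ ⊂ A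
      A′⊂A = p∩q⊆p A _ , a , a∈A , λ a∈A′ → proj₂ (x∈p∩∁q⁻ A ⁅ a ⁆ a∈A′) (x∈⁅x⁆ a)
      ∣A′∣≤∣B′∣ : ∣ A′ ∣ ≤ ∣ B′ ∣
      ∣A′∣≤∣B′∣ = s≤s⁻¹ (begin
        suc ∣ A′ ∣  ≡⟨ x∈p⇒∣p∣≡1+∣p∩∁⁅x⁆∣ a∈A ⟨
        ∣ A ∣       ≤⟨ ∣A∣≤∣B∣ ⟩
        ∣ B ∣       ≡⟨ x∈p⇒∣p∣≡1+∣p∩∁⁅x⁆∣ b∈B ⟩
        suc ∣ B′ ∣  ∎)
        where open ≤-Reasoning
      ⊆A∪B : (⁅ a ⁆ ∪ ⁅ b ⁆) ∪ (A′ ∪ B′) ⊆ A ∪ B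
      ⊆A∪B v∈ with x∈p∪q⁻ (⁅ a ⁆ ∪ ⁅ b ⁆) (A′ ∪ B′) v∈
      ... | inj₁ v∈e = x∈⁅u⁆∪⁅v⁆⁻ {P = _∈ A ∪ B} (x∈p∪q⁺ (inj₁ a∈A)) (x∈p∪q⁺ (inj₂ b∈B)) v∈e
      ... | inj₂ v∈′ with x∈p∪q⁻ A′ B′ v∈′
      ...   | inj₁ v∈A′ = x∈p∪q⁺ (inj₁ (p∩q⊆p A _ v∈A′))
      ...   | inj₂ v∈B′ = x∈p∪q⁺ (inj₂ (p∩q⊆p B _ v∈B′))
      a∉ : a ∉ A′ ∪ B′
      a∉ a∈ with x∈p∪q⁻ A′ B′ a∈
      ... | inj₁ a∈A′ = proj₂ (x∈p∩∁q⁻ A ⁅ a ⁆ a∈A′) (x∈⁅x⁆ a)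
      -- `A` and `B` are disjoint: a common vertex would be adjacent to itself.
      ... | inj₂ a∈B′ = irrefl refl (complete a∈A (p∩q⊆p B _ a∈B′))
      b∉ : b ∉ A′ ∪ B′
      b∉ b∈ with x∈p∪q⁻ A′ B′ b∈
      ... | inj₁ b∈A′ = irrefl refl (complete (p∩q⊆p A _ b∈A′) b∈B)
      ... | inj₂ b∈B′ = proj₂ (x∈p∩∁q⁻ B ⁅ b ⁆ b∈B′) (x∈⁅x⁆ b)
      d : Disjoint (⁅ a ⁆ ∪ ⁅ b ⁆) (A′ ∪ B′)
      d (v , v∈) with v∈e , v∈′ ← x∈p∩q⁻ (⁅ a ⁆ ∪ ⁅ b ⁆) (A′ ∪ B′) v∈ =
        x∈⁅u⁆∪⁅v⁆⁻ {P = _∉ A′ ∪ B′} a∉ b∉ v∈e v∈′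

  -- Confining the matching to `S` and its neighbourhood is what keeps the recursive matching of
  -- `S ∖ A` away from the vertices already used.
  matching-independent : WellCovered G → NoIsolatedVertices G → ∀ {S} → IsIndependent G S →
                         MatchingWithin S (S ∪ neighbourhood S)
  matching-independent wc noIso {S} = go S (⊂-wellFounded S)
    where
    go : ∀ S → Acc _⊂_ S → IsIndependent G S → MatchingWithin S (S ∪ neighbourhood S)
    go S (acc rec) indS with nonempty? S
    ... | no  e         = matching-∅ e
    ... | yes (s , s∈S) with x , s~x ← noIso s
      -- The search for `y` can start at the neighbour `x` of `s`, as `s` lies in
      -- `neighbours x ∩ S`.
      with ∃-⊆-minimal (λ y → nonempty? (neighbours y ∩ S)) (λ y → neighbours y ∩ S) x
             (s , x∈p∩q⁺ (∈-comprehension⁺ (x ~?_) (~-sym s~x) , s∈S))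
    ...   | y , (a , a∈A) , minimal =
      matching-mono (p⊆q∪p∩∁q S A) ⊆S∪N
        (matching-∪ (matching-complete complete ∣A∣≤∣B∣) (go S′ (rec S′⊂S) indS′) d)
      where
      A S′ : Subset n
      A  = neighbours y ∩ S
      S′ = S ∩ ∁ A

      A⊆S : A ⊆ S
      A⊆S = p∩q⊆q (neighbours y) S

      S′⊆S : S′ ⊆ S
      S′⊆S = p∩q⊆p S (∁ A)

      S′⊂S : S′ ⊂ S
      S′⊂S = S′⊆S , a , A⊆S a∈A , λ a∈S′ → proj₂ (x∈p∩∁q⁻ S A a∈S′) a∈A

      indS′ : IsIndependent G S′
      indS′ = independent-⊆ S′⊆S indS

      A⁺ : ∀ {v} → v ∈ S → y ~ v → v ∈ A
      A⁺ v∈S y~v = x∈p∩q⁺ (∈-comprehension⁺ (y ~?_) y~v , v∈S)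

      A⁻ : ∀ {v} → v ∈ A → y ~ v
      A⁻ v∈A = ∈-comprehension⁻ (y ~?_) (p∩q⊆p (neighbours y) S v∈A)

      -- All neighbours of `y` in `S` were collected in `A`, so none is left in `S′`.
      indS′∪y : IsIndependent G (S′ ∪ ⁅ y ⁆)
      indS′∪y = independent-∪ indS′ (independent-⁅⁆ y) λ {v} v∈S′ w∈ v~w →
        let v∈S , v∉A = x∈p∩∁q⁻ S A v∈S′
        in v∉A (A⁺ v∈S (~-sym (subst (v ~_) (x∈⁅y⁆⇒x≡y y w∈) v~w)))

      L : Subset n
      L = proj₁ (extend indS′∪y)

      maxL : IsMaximalIndependent G L
      maxL = proj₁ (proj₂ (extend indS′∪y))

      S′∪y⊆L : S′ ∪ ⁅ y ⁆ ⊆ L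
      S′∪y⊆L = proj₂ (proj₂ (extend indS′∪y))

      indL : IsIndependent G L
      indL = IsMaximalIndependent.independent maxL

      S′⊆L : S′ ⊆ L
      S′⊆L = S′∪y⊆L ∘ p⊆p∪q ⁅ y ⁆

      y∈L : y ∈ L
      y∈L = S′∪y⊆L (q⊆p∪q S′ ⁅ y ⁆ (x∈⁅x⁆ y))

      N B : Subset n
      N = neighbourhood S
      B = L ∩ N

      N⁺ : ∀ {u v} → u ∈ S → v ~ u → v ∈ N
      N⁺ u∈S v~u = ∈-comprehension⁺ (hasNeighbourIn? S) (_ , u∈S , v~u)

      A∩L-empty : ∀ {v} → v ∈ A → v ∉ L
      A∩L-empty v∈A v∈L = indL y∈L v∈L (A⁻ v∈A)

      complete : ∀ {v b} → v ∈ A → b ∈ B → v ~ b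
      complete {v} {b} v∈A b∈B
        with b∈L , b∈N ← x∈p∩q⁻ L N b∈B
        with u , u∈S , b~u ← ∈-comprehension⁻ (hasNeighbourIn? S) b∈N =
        -- The neighbours of `b` in `S` form a nonempty subset of `A`; by minimality they are all of
        -- `A`, so `v` is one of them.
        ~-sym (b~ (p∩q⊆p (neighbours b) S (minimal (u , b⁺ u∈S b~u) ⊆A v∈A)))
        where
        b⁺ : ∀ {w} → w ∈ S → b ~ w → w ∈ neighbours b ∩ S
        b⁺ w∈S b~w = x∈p∩q⁺ (∈-comprehension⁺ (b ~?_) b~w , w∈S)
        b~ : ∀ {w} → w ∈ neighbours b → b ~ w
        b~ = ∈-comprehension⁻ (b ~?_)
        ⊆A : neighbours b ∩ S ⊆ A
        ⊆A {w} w∈ with w∈Nb , w∈S ← x∈p∩q⁻ (neighbours b) S w∈ =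
          -- A neighbour of `b` in `S` outside `A` would lie in `S′`, hence in the independent set
          -- `L` together with `b`.
          decidable-stable (w ∈? A) (λ w∉A → indL b∈L (S′⊆L (x∈p∩∁q⁺ w∈S w∉A)) (b~ w∈Nb))

      ind-exchange : IsIndependent G ((L ∩ ∁ N) ∪ A)
      ind-exchange = independent-∪ (independent-⊆ (p∩q⊆p L (∁ N)) indL) (independent-⊆ A⊆S indS)
        -- Vertices outside `N` have no neighbour in `S`, hence none in `A`.
        (λ v∈ w∈A v~w → proj₂ (x∈p∩∁q⁻ L N v∈) (N⁺ (A⊆S w∈A) v~w))

      ∣A∣≤∣B∣ : ∣ A ∣ ≤ ∣ B ∣
      -- The exchanged set is no larger than `L`; cancelling the common part `L ∩ ∁ N` compares what
      -- was inserted with what was removed.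
      ∣A∣≤∣B∣ = +-cancelˡ-≤ (∣ L ∩ ∁ N ∣) (∣ A ∣) (∣ B ∣) (begin
        ∣ L ∩ ∁ N ∣ + ∣ A ∣   ≡⟨ ∣p∪q∣≡∣p∣+∣q∣ (L ∩ ∁ N) A d′ ⟨
        ∣ (L ∩ ∁ N) ∪ A ∣     ≤⟨ ∣independent∣≤∣maximal∣ wc ind-exchange maxL ⟩
        ∣ L ∣                 ≡⟨ ∣p∣≡∣p∩q∣+∣p∩∁q∣ L N ⟩
        ∣ B ∣ + ∣ L ∩ ∁ N ∣   ≡⟨ +-comm ∣ B ∣ _ ⟩
        ∣ L ∩ ∁ N ∣ + ∣ B ∣   ∎)
        where
        open ≤-Reasoning
        d′ : Disjoint (L ∩ ∁ N) A
        d′ (v , v∈) with v∈L , v∈A ← x∈p∩q⁻ (L ∩ ∁ N) A v∈ = A∩L-empty v∈A (p∩q⊆p L (∁ N) v∈L)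

      N′ : Subset n
      N′ = neighbourhood S′

      N′⁻ : ∀ {v} → v ∈ N′ → ∃[ u ] u ∈ S′ × v ~ u
      N′⁻ = ∈-comprehension⁻ (hasNeighbourIn? S′)

      -- `A` and `S′` are complementary in `S`. A vertex in `A` and `N′`, or in `B` and `S′`, would
      -- give an edge inside `S`; one in `B` and `N′` would give an edge inside `L`.
      d : Disjoint (A ∪ B) (S′ ∪ N′)
      d (v , v∈) with l , r ← x∈p∩q⁻ (A ∪ B) (S′ ∪ N′) v∈ with x∈p∪q⁻ A B l | x∈p∪q⁻ S′ N′ r
      ... | inj₁ v∈A | inj₁ v∈S′ = proj₂ (x∈p∩∁q⁻ S A v∈S′) v∈A
      ... | inj₁ v∈A | inj₂ v∈N′ with u , u∈S′ , v~u ← N′⁻ v∈N′ = indS (A⊆S v∈A) (S′⊆S u∈S′) v~u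
      ... | inj₂ v∈B | inj₁ v∈S′
        with u , u∈S , v~u ← ∈-comprehension⁻ (hasNeighbourIn? S) (p∩q⊆q L N v∈B) =
        indS (S′⊆S v∈S′) u∈S v~u
      ... | inj₂ v∈B | inj₂ v∈N′ with u , u∈S′ , v~u ← N′⁻ v∈N′ =
        indL (p∩q⊆p L N v∈B) (S′⊆L u∈S′) v~u

      ⊆S∪N : (A ∪ B) ∪ (S′ ∪ N′) ⊆ S ∪ N
      ⊆S∪N v∈ with x∈p∪q⁻ (A ∪ B) (S′ ∪ N′) v∈
      ... | inj₁ v∈A∪B = x∈p∪q⁺ ([ inj₁ ∘ A⊆S , inj₂ ∘ p∩q⊆q L N ]′ (x∈p∪q⁻ A B v∈A∪B))
      ... | inj₂ v∈′ with x∈p∪q⁻ S′ N′ v∈′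
      ...   | inj₁ v∈S′ = x∈p∪q⁺ (inj₁ (S′⊆S v∈S′))
      ...   | inj₂ v∈N′ with u , u∈S′ , v~u ← N′⁻ v∈N′ = x∈p∪q⁺ (inj₂ (N⁺ (S′⊆S u∈S′) v~u))

  -- The implications

  ∃maximal : ∃[ I ] IsMaximalIndependent G I
  ∃maximal with I , maxI , _ ← extend {⊥} (λ x∈⊥ → contradiction x∈⊥ ∉⊥) = I , maxI

  -- A matching saturating a maximal independent set `I` has at least `∣ I ∣` edges, which is half
  -- the order; being disjoint, they use up all vertices.
  veryWellCovered⇒perfectMatching : VeryWellCovered G → ∃[ M ] IsPerfectMatching G M
  veryWellCovered⇒perfectMatching vwc with I , maxI ← ∃maximal =
    matching m , record { edges = edges m ; disjoint = disjoint m ; covers = covers }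
    where
    open VeryWellCovered vwc
    indI : IsIndependent G I
    indI = IsMaximalIndependent.independent maxI
    m : MatchingWithin I (I ∪ neighbourhood I)
    m = matching-independent wellCovered noIsolated indI
    ∣I∣≤∣M∣ : ∣ I ∣ ≤ length (matching m)
    ∣I∣≤∣M∣ = ∣independent∣≤∣M∣ (edges m) (disjoint m) (saturates m) indI
    n≤∣⋃M∣ : n ≤ ∣ ⋃ (matching m) ∣
    n≤∣⋃M∣ = begin
      n                       ≡⟨ 2∣maximal∣≡n vwc maxI ⟨
      2 * ∣ I ∣               ≤⟨ *-monoʳ-≤ 2 ∣I∣≤∣M∣ ⟩
      2 * length (matching m) ≡⟨ *-comm 2 (length (matching m)) ⟩
      length (matching m) * 2 ≡⟨ ∣⋃edges∣≡2∣M∣ (edges m) (disjoint m) ⟨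
      ∣ ⋃ (matching m) ∣      ∎
      where open ≤-Reasoning
    covers : Covers (matching m)
    covers v = ∈⋃⁻ (matching m)
      (subst (v ∈_) (sym (∣p∣≡n⇒p≡⊤ (≤-antisym (∣p∣≤n (⋃ (matching m))) n≤∣⋃M∣))) ∈⊤)

  -- A perfect matching has as many edges as a maximal independent set has vertices. Since no edge
  -- contains two of these vertices, every edge contains one.
  veryWellCovered⇒strong : VeryWellCovered G → ∀ {M} → IsPerfectMatching G M →
                           All (IsStrongClique G) M
  veryWellCovered⇒strong vwc {M} pm = All.tabulate λ e∈M → record
    { clique = edge-clique (All.lookup edges′ e∈M)
    ; strong = λ maxI → 1≤∣p∣⇒Nonempty (All.lookup (meets maxI) e∈M)
    }
    where
    open IsPerfectMatching pm renaming (edges to edges′; disjoint to disjoint′)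
    meets : ∀ {I} → IsMaximalIndependent G I → All (λ e → 1 ≤ ∣ e ∩ I ∣) M
    meets {I} maxI = length≤sum⇒1≤ (λ e → ∣ e ∩ I ∣)
      (∣e∩J∣≤1 edges′ (IsMaximalIndependent.independent maxI))
      (≤-reflexive (trans ∣M∣≡∣I∣ (∣q∣≡sum disjoint′ (λ {v} _ → covers v))))
      where
      ∣M∣≡∣I∣ : length M ≡ ∣ I ∣
      ∣M∣≡∣I∣ = *-cancelˡ-≡ (length M) (∣ I ∣) 2
        (trans (*-comm 2 (length M)) (trans (∣M∣*2≡n pm) (sym (2∣maximal∣≡n vwc maxI))))

  -- A strong edge meets each maximal independent set in exactly one vertex, so all of these sets
  -- have size `length M`, half the order.
  strongMatching⇒veryWellCovered : NoIsolatedVertices G → ∀ {M} → IsPerfectMatching G M →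
                                   All (IsStrongClique G) M → VeryWellCovered G
  strongMatching⇒veryWellCovered noIso {M} pm strong = record
    { wellCovered = λ maxI maxJ → trans (∣maximal∣ maxI) (sym (∣maximal∣ maxJ))
    ; noIsolated  = noIso
    ; halfOrder   = length M , isα , trans (*-comm 2 (length M)) (∣M∣*2≡n pm)
    }
    where
    open IsPerfectMatching pm renaming (edges to edges′; disjoint to disjoint′)
    ∣maximal∣ : ∀ {I} → IsMaximalIndependent G I → ∣ I ∣ ≡ length M
    ∣maximal∣ {I} maxI = begin
      ∣ I ∣                              ≡⟨ ∣q∣≡sum disjoint′ (λ {v} _ → covers v) ⟩
      sum (map (λ e → ∣ e ∩ I ∣) M)      ≡⟨ sum-const (λ e → ∣ e ∩ I ∣) (All.map ∣C∩I∣≡1 strong) ⟩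
      length M * 1                       ≡⟨ *-identityʳ (length M) ⟩
      length M                           ∎
      where
      open ≡-Reasoning
      ∣C∩I∣≡1 : ∀ {C} → IsStrongClique G C → ∣ C ∩ I ∣ ≡ 1
      ∣C∩I∣≡1 C = ≤-antisym
        (∣clique∩independent∣≤1 (IsStrongClique.clique C) (IsMaximalIndependent.independent maxI))
        (Nonempty⇒1≤∣p∣ (IsStrongClique.strong C maxI))
    isα : IsIndependenceNumber G (length M)
    isα = record
      { attained = let I , maxI = ∃maximal in
          I , IsMaximalIndependent.independent maxI , ∣maximal∣ maxI
      ; bound    = ∣independent∣≤∣M∣ edges′ disjoint′ (λ {v} _ → covers v)
      }

  -- Three vertices of a clique form a triangle. A singleton is not strong: a maximal independent
  -- set through a neighbour of its vertex misses it.
  strongClique⇒edge : TriangleFree G → NoIsolatedVertices G → ∀ {C} → Nonempty C →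
                      IsStrongClique G C → IsEdge G C
  strongClique⇒edge tf noIso {C} (u , u∈C) C-strong with any? (λ v → v ∈? C ×-dec ¬? (u ≟ v))
  ... | yes (v , v∈C , u≢v) = u , v , u~v , ⊆-antisym C⊆ (x∈⁅u⁆∪⁅v⁆⁻ {P = _∈ C} u∈C v∈C)
    where
    open IsStrongClique C-strong
    u~v : u ~ v
    u~v = clique u∈C v∈C u≢v
    C⊆ : C ⊆ ⁅ u ⁆ ∪ ⁅ v ⁆
    C⊆ {w} w∈C with u ≟ w | v ≟ w
    ... | yes refl | _        = x∈p∪q⁺ (inj₁ (x∈⁅x⁆ u))
    ... | no  _    | yes refl = x∈p∪q⁺ (inj₂ (x∈⁅x⁆ v))
    ... | no  u≢w  | no  v≢w  = contradiction (clique u∈C w∈C u≢w) (tf u~v (clique v∈C w∈C v≢w))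
  ... | no  single
    with w , u~w ← noIso u
    with I , maxI , w⊆I ← extend (independent-⁅⁆ w)
    with x , x∈ ← IsStrongClique.strong C-strong maxI
    with x∈C , x∈I ← x∈p∩q⁻ C I x∈ =
    contradiction u~w (IsMaximalIndependent.independent maxI u∈I (w⊆I (x∈⁅x⁆ w)))
    where
    u∈I : u ∈ I
    -- `C` has no vertex besides `u`, so the point `x` where `I` meets `C` is `u`.
    u∈I = subst (_∈ I) (sym (decidable-stable (u ≟ x) (λ u≢x → single (x , x∈C , u≢x)))) x∈I

  -- The partition is itself the matching, as each block is an edge.
  localizable⇒strongMatching : TriangleFree G → NoIsolatedVertices G → Localizable G →
                               ∃[ M ] IsPerfectMatching G M × All (IsStrongClique G) M
  localizable⇒strongMatching tf noIso (ps , part , strong) = ps , pm , strong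
    where
    open IsPartition part renaming (disjoint to disjoint′)
    pm : IsPerfectMatching G ps
    pm = record
      { edges    = All.zipWith (λ (ne , s) → strongClique⇒edge tf noIso ne s) (nonempty , strong)
      ; disjoint = disjoint′
      ; covers   = covers
      }

  strongMatching⇒localizable : ∀ {M} → IsPerfectMatching G M → All (IsStrongClique G) M →
                               Localizable G
  strongMatching⇒localizable {M} pm strong = M , part , strong
    where
    open IsPerfectMatching pm renaming (edges to edges′; disjoint to disjoint′)
    part : IsPartition M
    part = record
      { nonempty = All.map edge-nonempty edges′
      ; disjoint = disjoint′
      ; covers   = covers
      }

mainTheorem8 : ∀ {n : ℕ} (G : Graph n) → TriangleFree G → NoIsolatedVertices G →
    (Localizable G ⇔ VeryWellCovered G) ×
    (VeryWellCovered G ⇔ (∃[ M ] IsPerfectMatching G M × All (IsStrongClique G) M)) ×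
    ((∃[ M ] IsPerfectMatching G M × All (IsStrongClique G) M) ⇔
    ((∃[ M ] IsPerfectMatching G M) × (∀ {M} → IsPerfectMatching G M → All (IsStrongClique G) M)))
mainTheorem8 G tf noIso =
  -- Both directions between (1) and (2) pass through (3).
  mk⇔ (3⇒2 ∘ localizable⇒strongMatching G tf noIso)
      (λ vwc → let _ , pm , strong = 2⇒3 vwc in strongMatching⇒localizable G pm strong) ,
  mk⇔ 2⇒3 3⇒2 ,
  mk⇔ (λ sm → veryWellCovered⇒perfectMatching G (3⇒2 sm) ,
              λ {_} pm → veryWellCovered⇒strong G (3⇒2 sm) pm)
      (λ ((M , pm) , strong) → M , pm , strong pm)
  where
  3⇒2 : (∃[ M ] IsPerfectMatching G M × All (IsStrongClique G) M) → VeryWellCovered G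
  3⇒2 (_ , pm , strong) = strongMatching⇒veryWellCovered G noIso pm strong
  2⇒3 : VeryWellCovered G → ∃[ M ] IsPerfectMatching G M × All (IsStrongClique G) M
  2⇒3 vwc = let M , pm = veryWellCovered⇒perfectMatching G vwc in M , pm , veryWellCovered⇒strong G vwc pm
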